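{- Let $N\ge1$ and $0\le K\le N$ be integers and let $S$ be a 2-string with $|S|=2K$. Then $$\lim_{x_N\to\infty}H_S(x_1,\dots,x_{N-1},x_N;\bm{z})=\begin{cases}H_S(x_1,\dots,x_{N-1};\bm{z}),& |S|\le 2N-2,\\ 0,&\text{otherwise (i.e. } |S|=2N).\end{cases}$$
   Context: **Weights.** All parameters ($q$ and the spectral parameters) are generic/indeterminates. For $i,j,k,\ell\in\{0,1,2\}$ the Izergin--Korepin vertex weight $W_{y/x}(i,j;k,\ell)$ ($i$ = bottom incoming state, $j$ = left incoming state, $k$ = top outgoing state, $\ell$ = right outgoing state; $x$ = parameter of the horizontal line, $y$ = parameter of the vertical line) depends on $x,y$ only through $y/x$, and, with $D=(x-q^2y)(x-q^3y)$, is given by $W(0,0;0,0)=W(2,2;2,2)=1$; $W(1,0;1,0)=W(2,1;2,1)=\frac{q^2(x-y)}{x-q^2y}$; $W(1,0;0,1)=W(2,1;1,2)=\frac{(1-q^2)x}{x-q^2y}$; $W(0,1;1,0)=W(1,2;2,1)=\frac{(1-q^2)y}{x-q^2y}$; $W(0,1;0,1)=W(1,2;1,2)=\frac{x-y}{x-q^2y}$; $W(2,0;2,0)=\frac{q^4(x-y)(x-qy)}{D}$; $W(2,0;1,1)=-\frac{q(1-q)^2(1+q)x(x-y)}{D}$; $W(2,0;0,2)=\frac{(1-q^2)x(x+qx-qy-q^3y)}{D}$; $W(1,1;2,0)=-\frac{q^4(1+q)(x-y)y}{D}$; $W(1,1;1,1)=\frac{ -qx^2+(1+q)(1-q^2+q^4)xy-q^4y^2}{D}$;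 $W(1,1;0,2)=\frac{(1+q)x(x-y)}{D}$; $W(0,2;2,0)=\frac{(1-q^2)(x+q^2x-q^2y-q^3y)y}{D}$; $W(0,2;1,1)=\frac{q(1-q)^2(1+q)(x-y)y}{D}$; $W(0,2;0,2)=\frac{(x-y)(x-qy)}{D}$; and $W=0$ in all other cases. **2-strings.** A 2-string is an infinite vector $S=(S_1,S_2,\dots)$ with $S_i\in\{0,1,2\}$ and only finitely many nonzero entries; $|S|=\sum_i S_i$. $\bm{z}=(z_1,z_2,\dots)$. **$F_S^I$.** For $I=(I_1,\dots,I_N)\in\{0,1,2\}^N$ with $|I|=\sum_r I_r=|S|$, choose $L$ with $S_c=0$ for $c>L$ and put $$F_S^I(x_1,\dots,x_N;\bm{z})=\sum\prod_{r=1}^{N}\prod_{c=1}^{L}W_{z_c/x_r}(v_{r-1,c},h_{r,c-1};v_{r,c},h_{r,c}),$$ summed over all $h_{r,c}\in\{0,1,2\}$ ($1\le r\le N$, $0\le c\le L$) and $v_{r,c}\in\{0,1,2\}$ ($0\le r\le N$, $1\le c\le L$) with $h_{r,0}=I_r$, $h_{r,L}=0$, $v_{0,c}=0$, $v_{N,c}=S_c$ (independent of $L$). **$H_S$.** For $0\le K\le N$ and $|S|=2K$, $$H_S(x_1,\dots,x_N;\bm{z})=\sum_{I\in\{0,1,2\}^N:\,|I|=2K}(-1)^{\mathfrak{c}_1(I)/2}(1-q^{ -1})^{\mathfrak{c}_1(I)}q^{ -\mathrm{inv}(I)}F_S^I(x_1,\dots,x_N;\bm{z}),$$ where $\mathfrak{c}_1(I)=\#\{r:I_r=1\}$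 and $\mathrm{inv}(I)=\sum_{1\le i<j\le N}I_i(2-I_j)$. For the empty primary alphabet, $H_{(0,0,\dots)}=1$. -}

module Defs where

open import Algebra.Apartness.Bundles using (HeytingField)
open import Algebra.Bundles using (CommutativeRing)
open import Data.Fin.Base using (Fin; zero; suc; toℕ; inject₁)
open import Data.Fin.Patterns using (0F; 1F; 2F)
import Data.Fin.Properties as Fin
open import Data.List.Base as List using (List; []; _∷_; allFin; cartesianProduct; cartesianProductWith; filter)
open import Data.Nat.Base as ℕ using (ℕ; zero; suc)
import Data.Nat.DivMod as ℕ
import Data.Nat.Properties as ℕ
open import Data.Product.Base using (_×_; _,_; proj₁; proj₂; ∃; ∃-syntax)
open import Data.Sum.Base using (_⊎_)
open import Data.Vec.Base as Vec using (Vec; []; _∷_; lookup; head; last)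
open import Data.Vec.Properties using (≡-dec)
open import Level using (Level; _⊔_) renaming (suc to lsuc)
open import Relation.Binary.Core using (Rel)
open import Relation.Binary.PropositionalEquality.Core using (_≡_)
open import Relation.Binary.Structures using (IsStrictPartialOrder)
open import Relation.Nullary.Decidable.Core using (Dec; _×-dec_)
open import Relation.Nullary.Negation.Core using (¬_)
open import Relation.Unary using (Pred)

------------------------------------------------------------------------
-- Limits at infinity in a field with an absolute value

record OrderedField r ρ₁ ρ₂ ρ₃ : Set (lsuc (r ⊔ ρ₁ ⊔ ρ₂ ⊔ ρ₃)) where
  infix 4 _<_ _≤_
  field
    heytingField : HeytingField r ρ₁ ρ₂
  open HeytingField heytingField public
  field
    _<_                  : Rel Carrier ρ₃
    isStrictPartialOrder : IsStrictPartialOrder _≈_ _<_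
    #⇒<⊎>                : ∀ {x y} → x # y → x < y ⊎ y < x
    <⇒#                  : ∀ {x y} → x < y → x # y
    +-monoʳ-<            : ∀ z {x y} → x < y → z + x < z + y
    *-pos                : ∀ {x y} → 0# < x → 0# < y → 0# < x * y
    0<1                  : 0# < 1#

  _≤_ : Rel Carrier ρ₃
  x ≤ y = ¬ (y < x)

module _ {c ℓ₁ ℓ₂ r ρ₁ ρ₂ ρ₃ : Level}
         (𝔽 : HeytingField c ℓ₁ ℓ₂) (𝕍 : OrderedField r ρ₁ ρ₂ ρ₃) where
  private
    module F = HeytingField 𝔽
    module R = OrderedField 𝕍

  record AbsoluteValue : Set (c ⊔ ℓ₁ ⊔ ℓ₂ ⊔ r ⊔ ρ₁ ⊔ ρ₃) where
    field
      ∣_∣      : F.Carrier → R.Carrier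
      ∣∣-cong  : ∀ {x y} → x F.≈ y → ∣ x ∣ R.≈ ∣ y ∣
      0≤∣∣     : ∀ x → R.0# R.≤ ∣ x ∣
      #0⇒0<∣∣  : ∀ {x} → x F.# F.0# → R.0# R.< ∣ x ∣
      0<∣∣⇒#0  : ∀ {x} → R.0# R.< ∣ x ∣ → x F.# F.0#
      ∣∣-*     : ∀ x y → ∣ x F.* y ∣ R.≈ ∣ x ∣ R.* ∣ y ∣
      triangle : ∀ x y → ∣ x F.+ y ∣ R.≤ ∣ x ∣ R.+ ∣ y ∣

-- f is only partially defined; part of the claim is that its domain contains
-- every x with ∣ x ∣ sufficiently large.
LimitAtInfinity : ∀ {c ℓ₁ ℓ₂ r ρ₁ ρ₂ ρ₃ p}
  {𝔽 : HeytingField c ℓ₁ ℓ₂} {𝕍 : OrderedField r ρ₁ ρ₂ ρ₃} → AbsoluteValue 𝔽 𝕍 →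
  (Dom : Pred (HeytingField.Carrier 𝔽) p) →
  (f : ∀ x → Dom x → HeytingField.Carrier 𝔽) → HeytingField.Carrier 𝔽 →
  Set (c ⊔ r ⊔ ρ₃ ⊔ p)
LimitAtInfinity {𝔽 = 𝔽} {𝕍} abs Dom f a =
  ∀ ε → 0# < ε → ∃[ M ] ∀ x → M < ∣ x ∣ →
  Dom x × (∀ (d : Dom x) → ∣ f x d - a ∣ < ε)
  where
    open OrderedField 𝕍 using (0#; _<_)
    open HeytingField 𝔽 using (_-_)
    open AbsoluteValue abs

------------------------------------------------------------------------
-- States and 2-strings

State : Set
State = Fin 3

-- Indices are shifted: entry c is S_{c+1}.
record TwoString : Set where
  field
    entry     : ℕ → State
    bound     : ℕ
    vanishing : ∀ c → bound ℕ.≤ c → entry c ≡ 0F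

  entries : Vec State bound
  entries = Vec.tabulate (λ c → entry (toℕ c))

weight : ∀ {n} → Vec State n → ℕ
weight I = Vec.sum (Vec.map toℕ I)

∣_∣ₛ : TwoString → ℕ
∣ S ∣ₛ = weight (TwoString.entries S)

c₁ : ∀ {n} → Vec State n → ℕ
c₁ = Vec.count (Fin._≟ 1F)

inv : ∀ {n} → Vec State n → ℕ
inv []      = 0
inv (i ∷ I) = Vec.sum (Vec.map (λ j → toℕ i ℕ.* (2 ℕ.∸ toℕ j)) I) ℕ.+ inv I

words : ∀ {a} {A : Set a} → List A → ∀ n → List (Vec A n)
words as zero    = [] ∷ []
words as (suc n) = cartesianProductWith _∷_ as (words as n)

states : ∀ n → List (Vec State n)
states = words (allFin 3)

-- h has rows r = 1,…,N and columns 0,…,L; v has rows 0,…,N and columns 1,…,L.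
Boundary : ∀ {N L} → Vec State N → Vec State L →
           Vec (Vec State (suc L)) N → Vec (Vec State L) (suc N) → Set
Boundary I S h v =
  Vec.map head h ≡ I × Vec.map last h ≡ Vec.replicate _ 0F ×
  head v ≡ Vec.replicate _ 0F × last v ≡ S

boundary? : ∀ {N L} (I : Vec State N) (S : Vec State L) h v → Dec (Boundary I S h v)
boundary? I S h v =
  ≡-dec Fin._≟_ (Vec.map head h) I ×-dec
  ≡-dec Fin._≟_ (Vec.map last h) (Vec.replicate _ 0F) ×-dec
  ≡-dec Fin._≟_ (head v) (Vec.replicate _ 0F) ×-dec
  ≡-dec Fin._≟_ (last v) S

configurations : ∀ {N L} → Vec State N → Vec State L →
                 List (Vec (Vec State (suc L)) N × Vec (Vec State L) (suc N))
configurations {N} {L} I S =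
  filter (λ (h , v) → boundary? I S h v)
    (cartesianProduct (words (states (suc L)) N) (words (states L) (suc N)))

------------------------------------------------------------------------
-- The Izergin–Korepin vertex model

module IzerginKorepin {c ℓ₁ ℓ₂} (𝔽 : HeytingField c ℓ₁ ℓ₂)
  (q : HeytingField.Carrier 𝔽) (q#0 : HeytingField._#_ 𝔽 q (HeytingField.0# 𝔽))
  (z : ℕ → HeytingField.Carrier 𝔽) where

  open HeytingField 𝔽

  commutativeRing : CommutativeRing c ℓ₁
  commutativeRing = record { isCommutativeRing = isCommutativeRing }

  open import Algebra.Properties.Semiring.Exp (CommutativeRing.semiring commutativeRing)
    using (_^_)
  open import Algebra.Properties.Monoid.Sum (CommutativeRing.*-monoid commutativeRing)
    using () renaming (sum to ∏)

  ∑ : ∀ {a} {A : Set a} → List A → (A → Carrier) → Carrier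
  ∑ as f = List.foldr (λ a s → f a + s) 0# as

  -- 1/(x − y)
  recip : ∀ {x y} → x # y → Carrier
  recip x#y = proj₁ (#⇒invertible x#y)

  q⁻¹ : Carrier
  q⁻¹ = recip q#0

  -- The denominators of the weights at spectral parameters x, y do not vanish.
  Admissible : Carrier → Carrier → Set ℓ₂
  Admissible x y = x # q ^ 2 * y × x # q ^ 3 * y

  -- W_{y/x}(i,j;k,ℓ) is W x y adm i j k ℓ.
  W : ∀ x y → Admissible x y → (i j k ℓ : State) → Carrier
  W x y (x#q²y , x#q³y) = w
    where
    d D⁻¹ : Carrier
    d   = recip x#q²y
    D⁻¹ = d * recip x#q³y

    w : State → State → State → State → Carrier
    w 0F 0F 0F 0F = 1#
    w 2F 2F 2F 2F = 1#
    w 1F 0F 1F 0F = q ^ 2 * (x - y) * d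
    w 2F 1F 2F 1F = q ^ 2 * (x - y) * d
    w 1F 0F 0F 1F = (1# - q ^ 2) * x * d
    w 2F 1F 1F 2F = (1# - q ^ 2) * x * d
    w 0F 1F 1F 0F = (1# - q ^ 2) * y * d
    w 1F 2F 2F 1F = (1# - q ^ 2) * y * d
    w 0F 1F 0F 1F = (x - y) * d
    w 1F 2F 1F 2F = (x - y) * d
    w 2F 0F 2F 0F = q ^ 4 * (x - y) * (x - q * y) * D⁻¹
    w 2F 0F 1F 1F = - (q * (1# - q) ^ 2 * (1# + q) * x * (x - y)) * D⁻¹
    w 2F 0F 0F 2F = (1# - q ^ 2) * x * (x + q * x - q * y - q ^ 3 * y) * D⁻¹
    w 1F 1F 2F 0F = - (q ^ 4 * (1# + q) * (x - y) * y) * D⁻¹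
    w 1F 1F 1F 1F = (- (q * x ^ 2) + (1# + q) * (1# - q ^ 2 + q ^ 4) * x * y - q ^ 4 * y ^ 2) * D⁻¹
    w 1F 1F 0F 2F = (1# + q) * x * (x - y) * D⁻¹
    w 0F 2F 2F 0F = (1# - q ^ 2) * (x + q ^ 2 * x - q ^ 2 * y - q ^ 3 * y) * y * D⁻¹
    w 0F 2F 1F 1F = q * (1# - q) ^ 2 * (1# + q) * (x - y) * y * D⁻¹
    w 0F 2F 0F 2F = (x - y) * (x - q * y) * D⁻¹
    w _  _  _  _  = 0#

  -- Values of a primary parameter at which all weights in the first L columns are defined.
  Regular : ℕ → Pred Carrier ℓ₂
  Regular L x = ∀ (c : Fin L) → Admissible x (z (toℕ c))

  Param : TwoString → Set (c ⊔ ℓ₂)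
  Param S = ∃ (Regular (TwoString.bound S))

  F : ∀ {N} (S : TwoString) (I : Vec State N) → Vec (Param S) N → Carrier
  F {N} S I xs = ∑ (configurations I entries) λ (h , v) →
    ∏ {N} λ r → ∏ {bound} λ c →
      W (proj₁ (lookup xs r)) (z (toℕ c)) (proj₂ (lookup xs r) c)
        (lookup (lookup v (inject₁ r)) c) (lookup (lookup h r) (inject₁ c))
        (lookup (lookup v (suc r)) c)     (lookup (lookup h r) (suc c))
    where open TwoString S

  -- Meaningful only when ∣ S ∣ₛ ≡ 2 * K; c₁ I is then even for every I in the sum.
  H : ∀ {N} (K : ℕ) (S : TwoString) → Vec (Param S) N → Carrier
  H {N} K S xs = ∑ (filter (λ I → weight I ℕ.≟ 2 ℕ.* K) (states N)) λ I →
    (- 1#) ^ (c₁ I ℕ./ 2) * (1# - q⁻¹) ^ c₁ I * q⁻¹ ^ inv I * F S I xs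

module Submission where

-- Why the limit holds. As x_N tends to infinity, every weight in the last row
-- tends to its value at (x, y) = (1, 0) (W-tends): weights are quotients of
-- forms of equal degree in x and y. At y = 0 every weight that lowers the
-- horizontal state to 0 vanishes (W∞-drop-to-0), and the last row has to end in
-- the horizontal state 0. Hence only a row with horizontal states all 0 survives
-- (row∞-nonzero). Such a row starts with I_N = 0, transmits its vertical
-- states unchanged, and has limiting weight q^(2 ∣ S ∣) (row∞-zeros-≢,
-- row∞-zeros-≡). This gives
--   lim F_S^(I,i) = q^(2 ∣ S ∣) F_S^I if i = 0, and 0 otherwise (F-tends).
-- On the other hand inv (I, 0) = inv I + 2 ∣ I ∣, and ∣ I ∣ = ∣ S ∣ for the words
-- in H_S, so the power of q cancels against the coefficient (coefficient-∷ʳ-0)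
-- and the limit of H_S is H_S in one variable less. If ∣ S ∣ > 2n, where n = N − 1,
-- no word of length n has weight ∣ S ∣, and that sum is empty (H-vanishes).
--
-- The finite sums are handled with brackets: filters become factors 0 or 1
-- (∑-filter), words are split at their last letter (∑-words-∷ʳ), and sums with
-- one surviving term are collapsed (∑-states-single). Limits are computed with
-- the usual rules, derived from the constructive ordered field axioms, together
-- with a calculus of leading coefficients for polynomials in x.

open import Defs
open import Algebra.Apartness.Bundles using (HeytingField)
open import Data.Bool.Base using (if_then_else_)
open import Data.Nat.Base as ℕ using (ℕ; suc)
open import Data.Nat.Properties using (_≤?_)
open import Data.Product.Base using (_,_)
open import Data.Vec.Base using (Vec; _∷ʳ_)
open import Relation.Binary.PropositionalEquality.Core using (_≡_)
open import Relation.Nullary.Decidable.Core using (does)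

open import Algebra.Bundles using (CommutativeRing)
open import Data.Bool.Base using (true; false)
open import Data.Fin.Base using (Fin; zero; suc; toℕ; inject₁)
open import Data.Fin.Patterns using (0F; 1F; 2F)
import Data.Fin.Properties as Fin
open import Data.List.Base as List using (List; allFin; cartesianProduct; cartesianProductWith; filter)
open import Data.Nat.Base using (zero)
import Data.Nat.DivMod as ℕ
import Data.Nat.Properties as ℕ
open import Data.Product.Base using (_×_; proj₁; proj₂; ∃; ∃-syntax)
open import Data.Sum.Base using (_⊎_; inj₁; inj₂)
open import Data.Vec.Base as Vec using ([]; _∷_; lookup; head; last; replicate)
open import Data.Vec.Properties using (≡-dec; map-∷ʳ; last-∷ʳ; ∷ʳ-injective; ∷-injective)
open import Level using (_⊔_)
open import Relation.Binary.PropositionalEquality as ≡ using (_≢_; module ≡-Reasoning)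
open import Relation.Binary.Structures using (IsStrictPartialOrder)
open import Relation.Nullary.Decidable.Core using (Dec; yes; no)
open import Relation.Nullary.Negation.Core using (¬_; contradiction)
import Algebra.Apartness.Properties.HeytingCommutativeRing as HeytingProperties
import Algebra.Properties.CommutativeSemigroup as CommutativeSemigroupProperties
import Algebra.Properties.Monoid.Sum as MonoidSum
import Algebra.Properties.Ring as RingProperties
import Algebra.Properties.Semiring.Exp as Exp
import Relation.Binary.Reasoning.Setoid as SetoidReasoning

-- Algebra in Heyting fields

module FieldProperties {c ℓ₁ ℓ₂} (𝔽 : HeytingField c ℓ₁ ℓ₂) where
  open HeytingField 𝔽 hiding (zero)
  open HeytingProperties heytingCommutativeRing public using (1#0; #-congˡ; x-0≈x; invertibleˡ⇒#)

  commRing : CommutativeRing c ℓ₁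
  commRing = record { isCommutativeRing = isCommutativeRing }

  open RingProperties (CommutativeRing.ring commRing) public
    using (-0#≈0#; -1*x≈-x; -‿+-comm; -‿distribˡ-*; x[y-z]≈xy-xz; [y-z]x≈yx-zx)
  open CommutativeSemigroupProperties
    (CommutativeRing.*-commutativeSemigroup commRing) public
    using () renaming (interchange to *-interchange)
  open CommutativeSemigroupProperties
    (CommutativeRing.+-commutativeSemigroup commRing) public
    using () renaming (interchange to +-interchange)
  open Exp (CommutativeRing.semiring commRing) public using (_^_; ^-homo-*; ^-congʳ)
  open MonoidSum (CommutativeRing.*-monoid commRing) public
    using () renaming (sum to ∏)
  open SetoidReasoning setoid

  [x-y]+y≈x : ∀ x y → (x - y) + y ≈ x
  [x-y]+y≈x x y = begin
    (x - y) + y   ≈⟨ +-assoc x (- y) y ⟩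
    x + (- y + y) ≈⟨ +-congˡ (-‿inverseˡ y) ⟩
    x + 0#        ≈⟨ +-identityʳ x ⟩
    x             ∎

  [x-y]+[y-z]≈x-z : ∀ x y z → (x - y) + (y - z) ≈ x - z
  [x-y]+[y-z]≈x-z x y z = begin
    (x - y) + (y - z) ≈⟨ +-assoc (x - y) y (- z) ⟨
    ((x - y) + y) - z ≈⟨ +-congʳ ([x-y]+y≈x x y) ⟩
    x - z             ∎

  #0⇒# : ∀ {x y} → x - y # 0# → x # y
  #0⇒# x-y#0 with #⇒invertible x-y#0
  ... | r , r*[x-y-0]≈1 , _ = invertibleˡ⇒# (r , trans (*-congˡ (sym (x-0≈x _))) r*[x-y-0]≈1)

  ^-inverse : ∀ {x y} → x * y ≈ 1# → ∀ n → x ^ n * y ^ n ≈ 1#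
  ^-inverse xy≈1 zero    = *-identityˡ 1#
  ^-inverse {x} {y} xy≈1 (suc n) = begin
    (x * x ^ n) * (y * y ^ n) ≈⟨ *-interchange x (x ^ n) y (y ^ n) ⟩
    (x * y) * (x ^ n * y ^ n) ≈⟨ *-cong xy≈1 (^-inverse xy≈1 n) ⟩
    1# * 1#                   ≈⟨ *-identityˡ 1# ⟩
    1#                        ∎

-- Ordered fields

module OrderedFieldProperties {r ρ₁ ρ₂ ρ₃} (𝕍 : OrderedField r ρ₁ ρ₂ ρ₃) where
  open OrderedField 𝕍
  open FieldProperties heytingField

  private module SPO = IsStrictPartialOrder isStrictPartialOrder

  <-trans : ∀ {x y z} → x < y → y < z → x < z
  <-trans = SPO.trans

  <-irrefl : ∀ {x} → ¬ (x < x)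
  <-irrefl = SPO.irrefl refl

  <-respʳ : ∀ {x y z} → y ≈ z → x < y → x < z
  <-respʳ = proj₁ SPO.<-resp-≈

  <-respˡ : ∀ {x y z} → y ≈ z → y < x → z < x
  <-respˡ = proj₂ SPO.<-resp-≈

  <-resp : ∀ {x x′ y y′} → x ≈ x′ → y ≈ y′ → x < y → x′ < y′
  <-resp x≈x′ y≈y′ x<y = <-respˡ x≈x′ (<-respʳ y≈y′ x<y)

  <-cotrans : ∀ {x y} → x < y → ∀ z → x < z ⊎ z < y
  <-cotrans x<y z with #-cotrans (<⇒# x<y) z
  <-cotrans x<y z | inj₁ x#z with #⇒<⊎> x#z
  ... | inj₁ x<z = inj₁ x<z
  ... | inj₂ z<x = inj₂ (<-trans z<x x<y)
  <-cotrans x<y z | inj₂ z#y with #⇒<⊎> z#y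
  ... | inj₁ z<y = inj₂ z<y
  ... | inj₂ y<z = inj₁ (<-trans x<y y<z)

  ≤-<-trans : ∀ {x y z} → x ≤ y → y < z → x < z
  ≤-<-trans {x} x≤y y<z with <-cotrans y<z x
  ... | inj₁ y<x = contradiction y<x x≤y
  ... | inj₂ x<z = x<z

  <-≤-trans : ∀ {x y z} → x < y → y ≤ z → x < z
  <-≤-trans {z = z} x<y y≤z with <-cotrans x<y z
  ... | inj₁ x<z = x<z
  ... | inj₂ z<y = contradiction z<y y≤z

  +-monoˡ-< : ∀ z {x y} → x < y → x + z < y + z
  +-monoˡ-< z x<y = <-resp (+-comm z _) (+-comm z _) (+-monoʳ-< z x<y)

  +-mono-< : ∀ {x y u v} → x < y → u < v → x + u < y + v
  +-mono-< {y = y} {u} x<y u<v = <-trans (+-monoˡ-< u x<y) (+-monoʳ-< y u<v)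

  +-cancelʳ-< : ∀ z {x y} → x + z < y + z → x < y
  +-cancelʳ-< z {x} {y} lt = <-resp (cancel x) (cancel y) (+-monoˡ-< (- z) lt)
    where
    cancel : ∀ x → (x + z) - z ≈ x
    cancel x = trans (+-assoc x z (- z)) (trans (+-congˡ (-‿inverseʳ z)) (+-identityʳ x))

  x<y⇒0<y-x : ∀ {x y} → x < y → 0# < y - x
  x<y⇒0<y-x {x} x<y = +-cancelʳ-< x (<-resp (sym (+-identityˡ x)) (sym ([x-y]+y≈x _ x)) x<y)

  x<x+1 : ∀ x → x < x + 1#
  x<x+1 x = <-respˡ (+-identityʳ x) (+-monoʳ-< x 0<1)

  *-monoʳ-< : ∀ {z x y} → 0# < z → x < y → z * x < z * y
  *-monoʳ-< {z} {x} {y} 0<z x<y =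
    <-resp (+-identityˡ (z * x)) (trans (+-congʳ (x[y-z]≈xy-xz z y x)) ([x-y]+y≈x (z * y) (z * x)))
      (+-monoˡ-< (z * x) (*-pos 0<z (x<y⇒0<y-x x<y)))

  positive-inverse : ∀ {x} → 0# < x → ∃[ y ] 0# < y × y * x ≈ 1#
  positive-inverse {x} 0<x with #⇒invertible (#-sym (<⇒# 0<x))
  ... | y , y*[x-0]≈1 , _ = y , 0<y , yx≈1
    where
    yx≈1 : y * x ≈ 1#
    yx≈1 = trans (*-congˡ (sym (x-0≈x x))) y*[x-0]≈1
    0<y : 0# < y
    0<y with #⇒<⊎> (#0⇒# (invertibleˡ⇒# (x , trans (*-congˡ (trans (x-0≈x _) (x-0≈x y))) (trans (*-comm x y) yx≈1))))
    ... | inj₂ 0<y = 0<y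
    ... | inj₁ y<0 = contradiction
      (<-trans 0<1 (<-resp (trans (*-comm x y) yx≈1) (zeroʳ x) (*-monoʳ-< 0<x y<0))) <-irrefl

  *-cancelˡ-< : ∀ {z x y} → 0# < z → z * x < z * y → x < y
  *-cancelˡ-< {z} 0<z lt with positive-inverse 0<z
  ... | z⁻¹ , 0<z⁻¹ , z⁻¹z≈1 = <-resp (cancel _) (cancel _) (*-monoʳ-< 0<z⁻¹ lt)
    where
    cancel : ∀ x → z⁻¹ * (z * x) ≈ x
    cancel x = trans (sym (*-assoc z⁻¹ z x)) (trans (*-congʳ z⁻¹z≈1) (*-identityˡ x))

  *-mono-< : ∀ {x y u v} → 0# ≤ x → x < y → 0# ≤ u → u < v → x * u < y * v
  *-mono-< {x} {y} {u} {v} 0≤x x<y 0≤u u<v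
    -- x v < y v, so x u is either less than y v, as wanted, or more than x v.
    with <-cotrans (<-resp (*-comm v x) (*-comm v y) (*-monoʳ-< (≤-<-trans 0≤u u<v) x<y)) (x * u)
  ... | inj₂ xu<yv = xu<yv
  -- The latter would force x < 0, since u < v.
  ... | inj₁ xv<xu = contradiction x<0 0≤x
    where
    [v-u]x<0 : (v - u) * x < (v - u) * 0#
    [v-u]x<0 = +-cancelʳ-< (x * u) (<-resp
      (sym (trans (+-congʳ (trans (*-comm (v - u) x) (x[y-z]≈xy-xz x v u))) ([x-y]+y≈x (x * v) (x * u))))
      (sym (trans (+-congʳ (zeroʳ (v - u))) (+-identityˡ (x * u))))
      xv<xu)
    x<0 : x < 0#
    x<0 = *-cancelˡ-< (x<y⇒0<y-x u<v) [v-u]x<0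

  half : ∀ {ε} → 0# < ε → ∃[ δ ] 0# < δ × δ + δ ≈ ε
  half {ε} 0<ε with positive-inverse (<-trans 0<1 (x<x+1 1#))
  ... | t , 0<t , t2≈1 = t * ε , *-pos 0<t 0<ε , (begin
    t * ε + t * ε      ≈⟨ distribʳ ε t t ⟨
    (t + t) * ε        ≈⟨ *-congʳ (+-cong (*-identityʳ t) (*-identityʳ t)) ⟨
    (t * 1# + t * 1#) * ε ≈⟨ *-congʳ (distribˡ t 1# 1#) ⟨
    t * (1# + 1#) * ε  ≈⟨ *-congʳ t2≈1 ⟩
    1# * ε             ≈⟨ *-identityˡ ε ⟩
    ε                  ∎)
    where open SetoidReasoning setoid

  -- The order is not decidable, so a maximum is unavailable; a bound slightly
  -- above it exists by cotransitivity.
  upper-bound : ∀ a b → ∃[ m ] (∀ {x} → m < x → a < x × b < x)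
  upper-bound a b with <-cotrans (x<x+1 a) b
  ... | inj₁ a<b   = b , λ b<x → <-trans a<b b<x , b<x
  ... | inj₂ b<a+1 = a + 1# , λ lt → <-trans (x<x+1 a) lt , <-trans b<a+1 lt

-- Limits at infinity

-- Limits of functions on A along ∣ x t ∣ → ∞, where x assigns to every t in A
-- the value in the field that is sent to infinity.
module Limits {c ℓ₁ ℓ₂ r ρ₁ ρ₂ ρ₃} {𝔽 : HeytingField c ℓ₁ ℓ₂} {𝕍 : OrderedField r ρ₁ ρ₂ ρ₃}
  (abs : AbsoluteValue 𝔽 𝕍) {a} {A : Set a} (x : A → HeytingField.Carrier 𝔽) where
  open HeytingField 𝔽 hiding (zero)
  open FieldProperties 𝔽
  open AbsoluteValue abs
  open OrderedFieldProperties 𝕍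
  private module R = OrderedField 𝕍
  open R using (_<_; _≤_)

  ∣0∣≈0 : ∣ 0# ∣ R.≈ R.0#
  ∣0∣≈0 = proj₁ (R.tight _ _) λ ∣0∣#0 → case (R.#⇒<⊎> ∣0∣#0)
    where
    case : ¬ (∣ 0# ∣ < R.0# ⊎ R.0# < ∣ 0# ∣)
    case (inj₁ lt) = 0≤∣∣ 0# lt
    case (inj₂ lt) = proj₂ (tight 0# 0#) refl (0<∣∣⇒#0 lt)

  -- The reverse triangle inequality ∣ y ∣ − ∣ w ∣ ≤ ∣ y − w ∣.
  ∣x∣<⇒<∣x-w∣ : ∀ {m y} w → m R.+ ∣ w ∣ < ∣ y ∣ → m < ∣ y - w ∣
  ∣x∣<⇒<∣x-w∣ {m} {y} w lt = +-cancelʳ-< ∣ w ∣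
    (<-≤-trans (<-respʳ (∣∣-cong (sym ([x-y]+y≈x y w))) lt) (triangle (y - w) w))

  -- P holds for all t with ∣ x t ∣ sufficiently large.
  Eventually : ∀ {p} → (A → Set p) → Set (a ⊔ r ⊔ ρ₃ ⊔ p)
  Eventually P = ∃[ M ] (∀ t → M < ∣ x t ∣ → P t)

  -- f tends to 0.
  Null : (A → Carrier) → Set (a ⊔ r ⊔ ρ₃)
  Null f = ∀ ε → R.0# < ε → Eventually (λ t → ∣ f t ∣ < ε)

  -- f tends to b. A record, so that f and b can be inferred from the type.
  record Tends (f : A → Carrier) (b : Carrier) : Set (a ⊔ r ⊔ ρ₃) where
    constructor from-null
    field difference-null : Null (λ t → f t - b)

  open Tends public

  eventually-map : ∀ {p q} {P : A → Set p} {Q : A → Set q} →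
                   (∀ {t} → P t → Q t) → Eventually P → Eventually Q
  eventually-map P⇒Q (M , h) = M , λ t lt → P⇒Q (h t lt)

  eventually-× : ∀ {p q} {P : A → Set p} {Q : A → Set q} →
                 Eventually P → Eventually Q → Eventually (λ t → P t × Q t)
  eventually-× (M₁ , h₁) (M₂ , h₂) with upper-bound M₁ M₂
  ... | M , above = M , λ t lt → h₁ t (proj₁ (above lt)) , h₂ t (proj₂ (above lt))

  eventually-∀ : ∀ {p n} {P : Fin n → A → Set p} →
                 (∀ i → Eventually (P i)) → Eventually (λ t → ∀ i → P i t)
  eventually-∀ {n = zero}  h = R.0# , λ _ _ ()
  eventually-∀ {n = suc n} h = eventually-map
    (λ { (p , ps) zero → p ; (p , ps) (suc i) → ps i })
    (eventually-× (h zero) (eventually-∀ (λ i → h (suc i))))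

  eventually-# : ∀ w → Eventually (λ t → x t # w)
  eventually-# w = ∣ w ∣ , λ t lt →
    #0⇒# (0<∣∣⇒#0 (∣x∣<⇒<∣x-w∣ w (<-respˡ (R.sym (R.+-identityˡ ∣ w ∣)) lt)))

  null-cong : ∀ {f g} → (∀ t → f t ≈ g t) → Null f → Null g
  null-cong f≈g h ε 0<ε = eventually-map (λ {t} → <-respˡ (∣∣-cong (f≈g t))) (h ε 0<ε)

  null-+ : ∀ {f g} → Null f → Null g → Null (λ t → f t + g t)
  null-+ hf hg ε 0<ε with half 0<ε
  ... | δ , 0<δ , δ+δ≈ε = eventually-map
    (λ (lf , lg) → ≤-<-trans (triangle _ _) (<-respʳ δ+δ≈ε (+-mono-< lf lg)))
    (eventually-× (hf δ 0<δ) (hg δ 0<δ))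

  null-scale : ∀ b {f} → Null f → Null (λ t → b * f t)
  null-scale b hf ε 0<ε with positive-inverse 0<B
    where
    0<B : R.0# < ∣ b ∣ R.+ R.1#
    0<B = ≤-<-trans (0≤∣∣ b) (x<x+1 ∣ b ∣)
  ... | B⁻¹ , 0<B⁻¹ , B⁻¹B≈1 = eventually-map
    (λ lt → <-resp (R.sym (∣∣-* b _)) B*[B⁻¹*ε]≈ε (*-mono-< (0≤∣∣ b) (x<x+1 ∣ b ∣) (0≤∣∣ _) lt))
    (hf (B⁻¹ R.* ε) (R.*-pos 0<B⁻¹ 0<ε))
    where
    B*[B⁻¹*ε]≈ε : (∣ b ∣ R.+ R.1#) R.* (B⁻¹ R.* ε) R.≈ ε
    B*[B⁻¹*ε]≈ε = R.trans (R.sym (R.*-assoc _ _ _))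
      (R.trans (R.*-congʳ (R.trans (R.*-comm _ _) B⁻¹B≈1)) (R.*-identityˡ ε))

  null-* : ∀ {f g} → Null f → Null g → Null (λ t → f t * g t)
  null-* hf hg ε 0<ε = eventually-map
    (λ (lf , lg) → <-resp (R.sym (∣∣-* _ _)) (R.*-identityʳ ε) (*-mono-< (0≤∣∣ _) lf (0≤∣∣ _) lg))
    (eventually-× (hf ε 0<ε) (hg R.1# R.0<1))

  -- The witness comes from ∣ x − w ∣ ∣ f ∣ = ∣ 1 ∣: once ∣ x − w ∣ exceeds
  -- ∣ 1 ∣ / ε, the other factor is below ε.
  null-recip : ∀ w {f} → (∀ t → f t * (x t - w) ≈ 1#) → Null f
  null-recip w {f} inverse ε 0<ε with positive-inverse 0<ε
  ... | ε⁻¹ , 0<ε⁻¹ , ε⁻¹ε≈1 = M , λ t lt → bound t (∣x∣<⇒<∣x-w∣ w lt)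
    where
    M : R.Carrier
    M = ε⁻¹ R.* ∣ 1# ∣ R.+ ∣ w ∣
    bound : ∀ t → ε⁻¹ R.* ∣ 1# ∣ < ∣ x t - w ∣ → ∣ f t ∣ < ε
    bound t lt = *-cancelˡ-< 0<∣x-w∣ (<-resp
      (R.trans (R.trans (R.sym (R.*-assoc ε ε⁻¹ ∣ 1# ∣))
                (R.trans (R.*-congʳ (R.trans (R.*-comm ε ε⁻¹) ε⁻¹ε≈1)) (R.*-identityˡ ∣ 1# ∣)))
        (R.trans (∣∣-cong (sym (trans (*-comm _ _) (inverse t)))) (∣∣-* _ _)))
      (R.*-comm ε _)
      (*-monoʳ-< 0<ε lt))
      where
      0<∣x-w∣ : R.0# < ∣ x t - w ∣
      0<∣x-w∣ = #0⇒0<∣∣ (invertibleˡ⇒# (f t , trans (*-congˡ (x-0≈x _)) (inverse t)))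

  tends-cong : ∀ {f g b d} → (∀ t → f t ≈ g t) → b ≈ d → Tends f b → Tends g d
  tends-cong f≈g b≈d (from-null h) = from-null (null-cong (λ t → +-cong (f≈g t) (-‿cong b≈d)) h)

  null⇒tends : ∀ {f} → Null f → Tends f 0#
  null⇒tends h = from-null (null-cong (λ t → sym (x-0≈x _)) h)

  tends-const : ∀ b → Tends (λ _ → b) b
  difference-null (tends-const b) ε 0<ε = R.0# , λ t _ →
    <-respˡ (R.sym (R.trans (∣∣-cong (-‿inverseʳ b)) ∣0∣≈0)) 0<ε

  tends-+ : ∀ {f g b d} → Tends f b → Tends g d → Tends (λ t → f t + g t) (b + d)
  tends-+ {f} {g} {b} {d} (from-null hf) (from-null hg) = from-null (null-cong (λ t → begin
    (f t - b) + (g t - d)     ≈⟨ +-interchange (f t) (- b) (g t) (- d) ⟩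
    (f t + g t) + (- b - d)   ≈⟨ +-congˡ (-‿+-comm b d) ⟩
    (f t + g t) - (b + d)     ∎) (null-+ hf hg))
    where
    open SetoidReasoning setoid

  -- fg − bd = (f − b)(g − d) + d(f − b) + b(g − d)
  tends-* : ∀ {f g b d} → Tends f b → Tends g d → Tends (λ t → f t * g t) (b * d)
  tends-* {f} {g} {b} {d} (from-null hf) (from-null hg) = from-null (null-cong (λ t → begin
    ((f t - b) * (g t - d) + d * (f t - b)) + b * (g t - d)
      ≈⟨ +-congʳ (+-congˡ (*-comm d (f t - b))) ⟩
    ((f t - b) * (g t - d) + (f t - b) * d) + b * (g t - d)
      ≈⟨ +-congʳ (distribˡ (f t - b) (g t - d) d) ⟨
    (f t - b) * ((g t - d) + d) + b * (g t - d)
      ≈⟨ +-congʳ (*-congˡ ([x-y]+y≈x (g t) d)) ⟩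
    (f t - b) * g t + b * (g t - d)
      ≈⟨ +-cong ([y-z]x≈yx-zx (g t) (f t) b) (x[y-z]≈xy-xz b (g t) d) ⟩
    (f t * g t - b * g t) + (b * g t - b * d)
      ≈⟨ [x-y]+[y-z]≈x-z (f t * g t) (b * g t) (b * d) ⟩
    f t * g t - b * d ∎)
    (null-+ (null-+ (null-* hf hg) (null-scale d hf)) (null-scale b hg)))
    where open SetoidReasoning setoid

  tends-neg : ∀ {f b} → Tends f b → Tends (λ t → - f t) (- b)
  tends-neg hf = tends-cong (λ t → -1*x≈-x _) (-1*x≈-x _) (tends-* (tends-const (- 1#)) hf)

  -- x f = 1 + w f, and f tends to 0.
  tends-recip : ∀ w {f} → (∀ t → f t * (x t - w) ≈ 1#) → Tends (λ t → x t * f t) 1#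
  tends-recip w {f} inverse = tends-cong
    (λ t → begin
      1# + w * f t                 ≈⟨ +-congʳ (inverse t) ⟨
      f t * (x t - w) + w * f t    ≈⟨ +-congʳ (*-comm (f t) (x t - w)) ⟩
      (x t - w) * f t + w * f t    ≈⟨ distribʳ (f t) (x t - w) w ⟨
      ((x t - w) + w) * f t        ≈⟨ *-congʳ ([x-y]+y≈x (x t) w) ⟩
      x t * f t                    ∎)
    (trans (+-congˡ (zeroʳ w)) (+-identityʳ 1#))
    (tends-+ (tends-const 1#) (tends-* (tends-const w) (null⇒tends (null-recip w {f} inverse))))
    where open SetoidReasoning setoid

  tends-∏ : ∀ n {f : Fin n → A → Carrier} {b} → (∀ i → Tends (f i) (b i)) →
            Tends (λ t → ∏ (λ i → f i t)) (∏ b)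
  tends-∏ zero    h = tends-const 1#
  tends-∏ (suc n) h = tends-* (h zero) (tends-∏ n (λ i → h (suc i)))

-- Sums over words

module Sums {ℓ₀ ℓ₁ ℓ₂} (𝔽 : HeytingField ℓ₀ ℓ₁ ℓ₂) (q : HeytingField.Carrier 𝔽)
  (q#0 : HeytingField._#_ 𝔽 q (HeytingField.0# 𝔽)) (z : ℕ → HeytingField.Carrier 𝔽) where
  open HeytingField 𝔽 hiding (zero)
  open FieldProperties 𝔽
  open IzerginKorepin 𝔽 q q#0 z
  open SetoidReasoning setoid

  -- Iverson bracket: x if the proposition holds, 0 otherwise.
  when : ∀ {p} {P : Set p} → Dec P → Carrier → Carrier
  when P? x = if does P? then x else 0#

  when-false : ∀ {p} {P : Set p} (P? : Dec P) {x} → (P → x ≈ 0#) → when P? x ≈ 0#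
  when-false (yes p) h = h p
  when-false (no _)  h = refl

  when-true : ∀ {p} {P : Set p} (P? : Dec P) {x} → P → when P? x ≈ x
  when-true (yes _) p = refl
  when-true (no ¬p) p = contradiction p ¬p

  when-cong : ∀ {p} {P Q : Set p} (P? : Dec P) (Q? : Dec Q) {x y} →
              (P → Q) → (Q → P) → (P → x ≈ y) → when P? x ≈ when Q? y
  when-cong (yes p) Q? P⇒Q Q⇒P x≈y = trans (x≈y p) (sym (when-true Q? (P⇒Q p)))
  when-cong (no ¬p) Q? P⇒Q Q⇒P x≈y = sym (when-false Q? λ q → contradiction (Q⇒P q) ¬p)

  when-* : ∀ {p} {P : Set p} (P? : Dec P) x y → when P? (x * y) ≈ x * when P? y
  when-* (yes _) x y = refl
  when-* (no _)  x y = sym (zeroʳ x)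

  module _ {a} {A : Set a} where

    ∑-cong : ∀ (as : List A) {f g} → (∀ x → f x ≈ g x) → ∑ as f ≈ ∑ as g
    ∑-cong List.[]       f≈g = refl
    ∑-cong (x List.∷ as) f≈g = +-cong (f≈g x) (∑-cong as f≈g)

    ∑-zero : ∀ (as : List A) {f} → (∀ x → f x ≈ 0#) → ∑ as f ≈ 0#
    ∑-zero List.[]       f≈0 = refl
    ∑-zero (x List.∷ as) f≈0 = trans (+-cong (f≈0 x) (∑-zero as f≈0)) (+-identityˡ 0#)

    ∑-*ˡ : ∀ (as : List A) b {f} → ∑ as (λ x → b * f x) ≈ b * ∑ as f
    ∑-*ˡ List.[]       b = sym (zeroʳ b)
    ∑-*ˡ (x List.∷ as) b = trans (+-congˡ (∑-*ˡ as b)) (sym (distribˡ b _ _))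

    ∑-++ : ∀ (as bs : List A) f → ∑ (as List.++ bs) f ≈ ∑ as f + ∑ bs f
    ∑-++ List.[]       bs f = sym (+-identityˡ _)
    ∑-++ (x List.∷ as) bs f = trans (+-congˡ (∑-++ as bs f)) (sym (+-assoc _ _ _))

    ∑-filter : ∀ {p} {P : A → Set p} (P? : ∀ x → Dec (P x)) as f →
               ∑ (filter P? as) f ≈ ∑ as (λ x → when (P? x) (f x))
    ∑-filter P? List.[]       f = refl
    ∑-filter P? (x List.∷ as) f with P? x
    ... | yes _ = +-congˡ (∑-filter P? as f)
    ... | no  _ = trans (∑-filter P? as f) (sym (+-identityˡ _))

  ∑-map : ∀ {a b} {A : Set a} {B : Set b} (g : A → B) as f → ∑ (List.map g as) f ≈ ∑ as (λ x → f (g x))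
  ∑-map g List.[]       f = refl
  ∑-map g (x List.∷ as) f = +-congˡ (∑-map g as f)

  ∑-cartesianProductWith : ∀ {a b c} {A : Set a} {B : Set b} {C : Set c} (g : A → B → C) as bs f →
    ∑ (cartesianProductWith g as bs) f ≈ ∑ as (λ x → ∑ bs (λ y → f (g x y)))
  ∑-cartesianProductWith g List.[]       bs f = refl
  ∑-cartesianProductWith g (x List.∷ as) bs f = trans (∑-++ (List.map (g x) bs) _ f)
    (+-cong (∑-map (g x) bs f) (∑-cartesianProductWith g as bs f))

  -- Words are generated from the first letter on; this splits off the last one.
  ∑-words-∷ʳ : ∀ {a} {A : Set a} (as : List A) n f →
    ∑ (words as (suc n)) f ≈ ∑ (words as n) (λ w → ∑ as (λ x → f (w ∷ʳ x)))
  ∑-words-∷ʳ as zero f = begin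
    ∑ (words as 1) f                         ≈⟨ ∑-cartesianProductWith _∷_ as (words as 0) f ⟩
    ∑ as (λ x → f (x ∷ []) + 0#)             ≈⟨ ∑-cong as (λ x → +-identityʳ _) ⟩
    ∑ as (λ x → f (x ∷ []))                  ≈⟨ +-identityʳ _ ⟨
    ∑ as (λ x → f (x ∷ [])) + 0#             ∎
  ∑-words-∷ʳ as (suc n) f = begin
    ∑ (words as (suc (suc n))) f
      ≈⟨ ∑-cartesianProductWith _∷_ as (words as (suc n)) f ⟩
    ∑ as (λ y → ∑ (words as (suc n)) (λ w → f (y ∷ w)))
      ≈⟨ ∑-cong as (λ y → ∑-words-∷ʳ as n (λ w → f (y ∷ w))) ⟩
    ∑ as (λ y → ∑ (words as n) (λ w → ∑ as (λ x → f (y ∷ (w ∷ʳ x)))))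
      ≈⟨ ∑-cartesianProductWith _∷_ as (words as n) (λ w → ∑ as (λ x → f (w ∷ʳ x))) ⟨
    ∑ (words as (suc n)) (λ w → ∑ as (λ x → f (w ∷ʳ x))) ∎

  ∑-allFin-single : ∀ f i → (∀ j → j ≢ i → f j ≈ 0#) → ∑ (allFin 3) f ≈ f i
  ∑-allFin-single f 0F h = begin
    f 0F + (f 1F + (f 2F + 0#)) ≈⟨ +-congˡ (+-cong (h 1F λ ()) (+-congʳ (h 2F λ ()))) ⟩
    f 0F + (0# + (0# + 0#))     ≈⟨ +-congˡ (trans (+-identityˡ _) (+-identityˡ 0#)) ⟩
    f 0F + 0#                   ≈⟨ +-identityʳ _ ⟩
    f 0F                        ∎
  ∑-allFin-single f 1F h = begin
    f 0F + (f 1F + (f 2F + 0#)) ≈⟨ +-cong (h 0F λ ()) (+-congˡ (+-congʳ (h 2F λ ()))) ⟩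
    0# + (f 1F + (0# + 0#))     ≈⟨ +-identityˡ _ ⟩
    f 1F + (0# + 0#)            ≈⟨ trans (+-congˡ (+-identityˡ 0#)) (+-identityʳ _) ⟩
    f 1F                        ∎
  ∑-allFin-single f 2F h = begin
    f 0F + (f 1F + (f 2F + 0#)) ≈⟨ +-cong (h 0F λ ()) (+-cong (h 1F λ ()) (+-identityʳ _)) ⟩
    0# + (0# + f 2F)            ≈⟨ trans (+-identityˡ _) (+-identityˡ _) ⟩
    f 2F                        ∎

  ∑-states-single : ∀ n f (J : Vec State n) → (∀ I → I ≢ J → f I ≈ 0#) → ∑ (states n) f ≈ f J
  ∑-states-single zero    f []      h = +-identityʳ _
  ∑-states-single (suc n) f (j ∷ J) h = begin
    ∑ (states (suc n)) f
      ≈⟨ ∑-cartesianProductWith _∷_ (allFin 3) (states n) f ⟩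
    ∑ (allFin 3) (λ i → ∑ (states n) (λ I → f (i ∷ I)))
      ≈⟨ ∑-allFin-single _ j (λ i i≢j → ∑-zero (states n) λ I → h (i ∷ I) λ eq → i≢j (proj₁ (∷-injective eq))) ⟩
    ∑ (states n) (λ I → f (j ∷ I))
      ≈⟨ ∑-states-single n (λ I → f (j ∷ I)) J (λ I I≢J → h (j ∷ I) λ eq → I≢J (proj₂ (∷-injective eq))) ⟩
    f (j ∷ J) ∎

-- Weights of the last row

module Weights {ℓ₀ ℓ₁ ℓ₂ r ρ₁ ρ₂ ρ₃} (𝔽 : HeytingField ℓ₀ ℓ₁ ℓ₂) (𝕍 : OrderedField r ρ₁ ρ₂ ρ₃)
  (abs : AbsoluteValue 𝔽 𝕍) (q : HeytingField.Carrier 𝔽) (q#0 : HeytingField._#_ 𝔽 q (HeytingField.0# 𝔽))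
  (z : ℕ → HeytingField.Carrier 𝔽) where
  open HeytingField 𝔽 hiding (zero)
  open FieldProperties 𝔽
  open IzerginKorepin 𝔽 q q#0 z
  open SetoidReasoning setoid

  recip-inverse : ∀ {x y} (x#y : x # y) → recip x#y * (x - y) ≈ 1#
  recip-inverse x#y = proj₁ (proj₂ (#⇒invertible x#y))

  recip-1 : ∀ w (1#w0 : 1# # w * 0#) → recip 1#w0 ≈ 1#
  recip-1 w 1#w0 = begin
    recip 1#w0                   ≈⟨ *-identityʳ _ ⟨
    recip 1#w0 * 1#              ≈⟨ *-congˡ (x-0≈x 1#) ⟨
    recip 1#w0 * (1# - 0#)       ≈⟨ *-congˡ (+-congˡ (-‿cong (zeroʳ w))) ⟨
    recip 1#w0 * (1# - w * 0#)   ≈⟨ recip-inverse 1#w0 ⟩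
    1#                           ∎

  admissible-1-0 : Admissible 1# 0#
  admissible-1-0 = #-congˡ (sym (zeroʳ (q ^ 2))) 1#0 , #-congˡ (sym (zeroʳ (q ^ 3))) 1#0

  -- The weights depend on x and y through y/x only, so their limit as x tends
  -- to infinity is their value at (x, y) = (1, 0).
  W∞ : (i j k ℓ : State) → Carrier
  W∞ = W 1# 0# admissible-1-0

  module _ (L : ℕ) (c : Fin L) where
    open Limits abs {A = ∃ (Regular L)} proj₁

    private
      y : Carrier
      y = z (toℕ c)

      d d′ : ∃ (Regular L) → Carrier
      d  (x , reg) = recip (proj₁ (reg c))
      d′ (x , reg) = recip (proj₂ (reg c))

      d∞ d′∞ : Carrier
      d∞  = recip (proj₁ admissible-1-0)
      d′∞ = recip (proj₂ admissible-1-0)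

    -- f grows like b times the k-th power of x. Since x itself need not be
    -- invertible, the growth is measured with d, whose product with x tends to 1.
    infix 4 _∼[_]_
    record _∼[_]_ (f : ∃ (Regular L) → Carrier) (k : ℕ) (b : Carrier) : Set (ℓ₀ ⊔ r ⊔ ρ₃ ⊔ ℓ₂) where
      constructor degree
      field scaled : Tends (λ t → f t * d t ^ k) b
    open _∼[_]_

    infixl 7 _⊗_
    infixl 6 _⊕_ _⊖_

    -- The combinators below follow the shape of a numerator, so that its limit is
    -- the same expression with x replaced by 1 and y by 0.

    const : ∀ b → (λ _ → b) ∼[ 0 ] b
    const b = degree (tends-cong (λ _ → sym (*-identityʳ b)) refl (tends-const b))

    X : proj₁ ∼[ 1 ] 1#
    X = degree (tends-cong (λ _ → *-congˡ (sym (*-identityʳ _))) refl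
          (tends-recip (q ^ 2 * y) {d} λ (_ , reg) → recip-inverse (proj₁ (reg c))))

    Y : (λ _ → y) ∼[ 1 ] 0#
    Y = degree (tends-cong (λ _ → *-congˡ (sym (*-identityʳ _))) (zeroʳ y)
          (tends-* (tends-const y) (null⇒tends
            (null-recip (q ^ 2 * y) {d} λ (_ , reg) → recip-inverse (proj₁ (reg c))))))

    _⊗_ : ∀ {f g k l b e} → f ∼[ k ] b → g ∼[ l ] e → (λ t → f t * g t) ∼[ k ℕ.+ l ] b * e
    _⊗_ {f} {g} {k} {l} (degree hf) (degree hg) = degree (tends-cong
      (λ t → trans (*-interchange (f t) (d t ^ k) (g t) (d t ^ l)) (*-congˡ (sym (^-homo-* (d t) k l))))
      refl (tends-* hf hg))

    _⊕_ : ∀ {f g k b e} → f ∼[ k ] b → g ∼[ k ] e → (λ t → f t + g t) ∼[ k ] b + e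
    degree hf ⊕ degree hg = degree (tends-cong (λ t → sym (distribʳ _ _ _)) refl (tends-+ hf hg))

    ⊝_ : ∀ {f k b} → f ∼[ k ] b → (λ t → - f t) ∼[ k ] - b
    ⊝ degree hf = degree (tends-cong (λ t → -‿distribˡ-* _ _) refl (tends-neg hf))

    _⊖_ : ∀ {f g k b e} → f ∼[ k ] b → g ∼[ k ] e → (λ t → f t - g t) ∼[ k ] b - e
    hf ⊖ hg = hf ⊕ (⊝ hg)

    -- Limits of the weights with denominator x − q²y.
    deg₁ : ∀ {f b} → f ∼[ 1 ] b → Tends (λ t → f t * d t) (b * d∞)
    deg₁ {b = b} (degree hf) = tends-cong (λ t → *-congˡ (*-identityʳ (d t)))
      (sym (trans (*-congˡ (recip-1 (q ^ 2) _)) (*-identityʳ b))) hf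

    -- Limits of the weights with denominator (x − q²y)(x − q³y), where
    -- d′ is the inverse of x − q³y, while degrees are measured with the
    -- inverse d of x − q²y: the factor d′ (x − q²y), which tends to 1, compensates.
    deg₂ : ∀ {f b} → f ∼[ 2 ] b → Tends (λ t → f t * (d t * d′ t)) (b * (d∞ * d′∞))
    deg₂ {f} {b} (degree hf) = tends-cong
      (λ t@(x , reg) → begin
        f t * (d t * (d t * 1#)) * ((x - w) * d′ t)   ≈⟨ *-congʳ (*-congˡ (*-congˡ (*-identityʳ (d t)))) ⟩
        f t * (d t * d t) * ((x - w) * d′ t)          ≈⟨ *-assoc _ _ _ ⟩
        f t * (d t * d t * ((x - w) * d′ t))          ≈⟨ *-congˡ (*-assoc _ _ _) ⟩
        f t * (d t * (d t * ((x - w) * d′ t)))        ≈⟨ *-congˡ (*-congˡ (*-assoc _ _ _)) ⟨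
        f t * (d t * (d t * (x - w) * d′ t))          ≈⟨ *-congˡ (*-congˡ (*-congʳ (recip-inverse (proj₁ (reg c))))) ⟩
        f t * (d t * (1# * d′ t))                     ≈⟨ *-congˡ (*-congˡ (*-identityˡ _)) ⟩
        f t * (d t * d′ t)                            ∎)
      (*-congˡ (sym (trans (*-cong (recip-1 (q ^ 2) _) (recip-1 (q ^ 3) _)) (*-identityˡ 1#))))
      (tends-* hf [x-w]d′→1)
      where
      w : Carrier
      w = q ^ 2 * y

      inverse′ : ∀ t → d′ t * (proj₁ t - q ^ 3 * y) ≈ 1#
      inverse′ (_ , reg) = recip-inverse (proj₂ (reg c))

      [x-w]d′→1 : Tends (λ t → (proj₁ t - w) * d′ t) 1#
      [x-w]d′→1 = tends-cong (λ t → sym (distribʳ (d′ t) (proj₁ t) (- w)))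
        (trans (+-congˡ (zeroʳ (- w))) (+-identityʳ 1#))
        (tends-+ (tends-recip (q ^ 3 * y) {d′} inverse′)
          (tends-* (tends-const (- w)) (null⇒tends (null-recip (q ^ 3 * y) {d′} inverse′))))

    W-tends : ∀ i j k ℓ → Tends (λ (x , reg) → W x y (reg c) i j k ℓ) (W∞ i j k ℓ)
    W-tends 0F 0F 0F 0F = tends-const 1#
    W-tends 0F 0F 0F 1F = tends-const 0#
    W-tends 0F 0F 0F 2F = tends-const 0#
    W-tends 0F 0F 1F _  = tends-const 0#
    W-tends 0F 0F 2F _  = tends-const 0#
    W-tends 0F 1F 0F 0F = tends-const 0#
    W-tends 0F 1F 0F 1F = deg₁ (X ⊖ Y)
    W-tends 0F 1F 0F 2F = tends-const 0#
    W-tends 0F 1F 1F 0F = deg₁ (const (1# - q ^ 2) ⊗ Y)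
    W-tends 0F 1F 1F 1F = tends-const 0#
    W-tends 0F 1F 1F 2F = tends-const 0#
    W-tends 0F 1F 2F _  = tends-const 0#
    W-tends 0F 2F 0F 0F = tends-const 0#
    W-tends 0F 2F 0F 1F = tends-const 0#
    W-tends 0F 2F 0F 2F = deg₂ ((X ⊖ Y) ⊗ (X ⊖ const q ⊗ Y))
    W-tends 0F 2F 1F 0F = tends-const 0#
    W-tends 0F 2F 1F 1F = deg₂ (const (q * (1# - q) ^ 2 * (1# + q)) ⊗ (X ⊖ Y) ⊗ Y)
    W-tends 0F 2F 1F 2F = tends-const 0#
    W-tends 0F 2F 2F 0F = deg₂ (const (1# - q ^ 2) ⊗ (X ⊕ const (q ^ 2) ⊗ X ⊖ const (q ^ 2) ⊗ Y ⊖ const (q ^ 3) ⊗ Y) ⊗ Y)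
    W-tends 0F 2F 2F 1F = tends-const 0#
    W-tends 0F 2F 2F 2F = tends-const 0#
    W-tends 1F 0F 0F 0F = tends-const 0#
    W-tends 1F 0F 0F 1F = deg₁ (const (1# - q ^ 2) ⊗ X)
    W-tends 1F 0F 0F 2F = tends-const 0#
    W-tends 1F 0F 1F 0F = deg₁ (const (q ^ 2) ⊗ (X ⊖ Y))
    W-tends 1F 0F 1F 1F = tends-const 0#
    W-tends 1F 0F 1F 2F = tends-const 0#
    W-tends 1F 0F 2F _  = tends-const 0#
    W-tends 1F 1F 0F 0F = tends-const 0#
    W-tends 1F 1F 0F 1F = tends-const 0#
    W-tends 1F 1F 0F 2F = deg₂ (const (1# + q) ⊗ X ⊗ (X ⊖ Y))
    W-tends 1F 1F 1F 0F = tends-const 0#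
    W-tends 1F 1F 1F 1F = deg₂ (⊝ (const q ⊗ (X ⊗ (X ⊗ const 1#)))
           ⊕ const ((1# + q) * (1# - q ^ 2 + q ^ 4)) ⊗ X ⊗ Y
           ⊖ const (q ^ 4) ⊗ (Y ⊗ (Y ⊗ const 1#)))
    W-tends 1F 1F 1F 2F = tends-const 0#
    W-tends 1F 1F 2F 0F = deg₂ (⊝ (const (q ^ 4 * (1# + q)) ⊗ (X ⊖ Y) ⊗ Y))
    W-tends 1F 1F 2F 1F = tends-const 0#
    W-tends 1F 1F 2F 2F = tends-const 0#
    W-tends 1F 2F 0F _  = tends-const 0#
    W-tends 1F 2F 1F 0F = tends-const 0#
    W-tends 1F 2F 1F 1F = tends-const 0#
    W-tends 1F 2F 1F 2F = deg₁ (X ⊖ Y)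
    W-tends 1F 2F 2F 0F = tends-const 0#
    W-tends 1F 2F 2F 1F = deg₁ (const (1# - q ^ 2) ⊗ Y)
    W-tends 1F 2F 2F 2F = tends-const 0#
    W-tends 2F 0F 0F 0F = tends-const 0#
    W-tends 2F 0F 0F 1F = tends-const 0#
    W-tends 2F 0F 0F 2F = deg₂ (const (1# - q ^ 2) ⊗ X ⊗ (X ⊕ const q ⊗ X ⊖ const q ⊗ Y ⊖ const (q ^ 3) ⊗ Y))
    W-tends 2F 0F 1F 0F = tends-const 0#
    W-tends 2F 0F 1F 1F = deg₂ (⊝ (const (q * (1# - q) ^ 2 * (1# + q)) ⊗ X ⊗ (X ⊖ Y)))
    W-tends 2F 0F 1F 2F = tends-const 0#
    W-tends 2F 0F 2F 0F = deg₂ (const (q ^ 4) ⊗ (X ⊖ Y) ⊗ (X ⊖ const q ⊗ Y))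
    W-tends 2F 0F 2F 1F = tends-const 0#
    W-tends 2F 0F 2F 2F = tends-const 0#
    W-tends 2F 1F 0F _  = tends-const 0#
    W-tends 2F 1F 1F 0F = tends-const 0#
    W-tends 2F 1F 1F 1F = tends-const 0#
    W-tends 2F 1F 1F 2F = deg₁ (const (1# - q ^ 2) ⊗ X)
    W-tends 2F 1F 2F 0F = tends-const 0#
    W-tends 2F 1F 2F 1F = deg₁ (const (q ^ 2) ⊗ (X ⊖ Y))
    W-tends 2F 1F 2F 2F = tends-const 0#
    W-tends 2F 2F 0F _  = tends-const 0#
    W-tends 2F 2F 1F _  = tends-const 0#
    W-tends 2F 2F 2F 0F = tends-const 0#
    W-tends 2F 2F 2F 1F = tends-const 0#
    W-tends 2F 2F 2F 2F = tends-const 1#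

  -- Every nonzero weight that lowers the horizontal state has a factor y in its numerator.
  W∞-drop-to-0 : ∀ i (j : Fin 2) k → W∞ i (suc j) k 0F ≈ 0#
  W∞-drop-to-0 0F 0F 0F = refl
  W∞-drop-to-0 0F 0F 1F = trans (*-congʳ (zeroʳ _)) (zeroˡ _)
  W∞-drop-to-0 0F 0F 2F = refl
  W∞-drop-to-0 1F 0F 0F = refl
  W∞-drop-to-0 1F 0F 1F = refl
  W∞-drop-to-0 1F 0F 2F = trans (*-congʳ (trans (-‿cong (zeroʳ _)) -0#≈0#)) (zeroˡ _)
  W∞-drop-to-0 2F 0F 0F = refl
  W∞-drop-to-0 2F 0F 1F = refl
  W∞-drop-to-0 2F 0F 2F = refl
  W∞-drop-to-0 0F 1F 0F = refl
  W∞-drop-to-0 0F 1F 1F = refl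
  W∞-drop-to-0 0F 1F 2F = trans (*-congʳ (zeroʳ _)) (zeroˡ _)
  W∞-drop-to-0 1F 1F 0F = refl
  W∞-drop-to-0 1F 1F 1F = refl
  W∞-drop-to-0 1F 1F 2F = refl
  W∞-drop-to-0 2F 1F 0F = refl
  W∞-drop-to-0 2F 1F 1F = refl
  W∞-drop-to-0 2F 1F 2F = refl

  W∞-zero-≢ : ∀ i k → i ≢ k → W∞ i 0F k 0F ≈ 0#
  W∞-zero-≢ 0F 0F i≢k = contradiction ≡.refl i≢k
  W∞-zero-≢ 0F 1F _   = refl
  W∞-zero-≢ 0F 2F _   = refl
  W∞-zero-≢ 1F 0F _   = refl
  W∞-zero-≢ 1F 1F i≢k = contradiction ≡.refl i≢k
  W∞-zero-≢ 1F 2F _   = refl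
  W∞-zero-≢ 2F 0F _   = refl
  W∞-zero-≢ 2F 1F _   = refl
  W∞-zero-≢ 2F 2F i≢k = contradiction ≡.refl i≢k

  W∞-zero-≡ : ∀ i → W∞ i 0F i 0F ≈ q ^ (2 ℕ.* toℕ i)
  W∞-zero-≡ 0F = refl
  W∞-zero-≡ 1F = begin
    q ^ 2 * (1# - 0#) * _   ≈⟨ *-cong (*-congˡ (x-0≈x 1#)) (recip-1 (q ^ 2) _) ⟩
    q ^ 2 * 1# * 1#         ≈⟨ trans (*-identityʳ _) (*-identityʳ _) ⟩
    q ^ 2                   ∎
  W∞-zero-≡ 2F = begin
    q ^ 4 * (1# - 0#) * (1# - q * 0#) * _
      ≈⟨ *-cong (*-cong (*-congˡ (x-0≈x 1#)) (trans (+-congˡ (-‿cong (zeroʳ q))) (x-0≈x 1#)))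
                (trans (*-cong (recip-1 (q ^ 2) _) (recip-1 (q ^ 3) _)) (*-identityˡ 1#)) ⟩
    q ^ 4 * 1# * 1# * 1#
      ≈⟨ trans (*-identityʳ _) (trans (*-identityʳ _) (*-identityʳ _)) ⟩
    q ^ 4 ∎

  -- The weight of one row with parameter x, with vertical states u below and s above it and
  -- horizontal states ρ along it.
  row : ∀ {L} → ∃ (Regular L) → Vec State L → Vec State (suc L) → Vec State L → Carrier
  row (x , reg) u ρ s = ∏ λ c →
    W x (z (toℕ c)) (reg c) (lookup u c) (lookup ρ (inject₁ c)) (lookup s c) (lookup ρ (suc c))

  -- The limit of the weight of a row as its parameter tends to infinity.
  row∞ : ∀ {L} → Vec State L → Vec State (suc L) → Vec State L → Carrier
  row∞ u ρ s = ∏ λ c → W∞ (lookup u c) (lookup ρ (inject₁ c)) (lookup s c) (lookup ρ (suc c))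

  -- The empty row.
  zeros : ∀ n → Vec State n
  zeros n = replicate n 0F

  -- At the last place where ρ is nonzero it drops to 0.
  row∞-nonzero : ∀ {L} (u : Vec State L) ρ s → last ρ ≡ 0F → ρ ≢ zeros (suc L) → row∞ u ρ s ≈ 0#
  row∞-nonzero []      (0F ∷ [])    []      _    ρ≢0 = contradiction ≡.refl ρ≢0
  row∞-nonzero (i ∷ u) (j ∷ ℓ ∷ ρ) (k ∷ s) last≡0 ρ≢0
    with ≡-dec Fin._≟_ (ℓ ∷ ρ) (zeros _)
  ... | no  ℓρ≢0   = trans (*-congˡ (row∞-nonzero u (ℓ ∷ ρ) s last≡0 ℓρ≢0)) (zeroʳ _)
  ... | yes ≡.refl with j
  ...   | 0F    = contradiction ≡.refl ρ≢0
  ...   | suc j = trans (*-congʳ (W∞-drop-to-0 i j k)) (zeroˡ _)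

  -- Along an empty row the vertical states cannot change.
  row∞-zeros-≢ : ∀ {L} (u s : Vec State L) → u ≢ s → row∞ u (zeros (suc L)) s ≈ 0#
  row∞-zeros-≢ []      []      u≢s = contradiction ≡.refl u≢s
  row∞-zeros-≢ (i ∷ u) (k ∷ s) iu≢ks with i Fin.≟ k
  ... | no  i≢k    = trans (*-congʳ (W∞-zero-≢ i k i≢k)) (zeroˡ _)
  ... | yes ≡.refl = trans (*-congˡ (row∞-zeros-≢ u s λ u≡s → iu≢ks (≡.cong (i ∷_) u≡s))) (zeroʳ _)

  row∞-zeros-≡ : ∀ {L} (s : Vec State L) → row∞ s (zeros (suc L)) s ≈ q ^ (2 ℕ.* weight s)
  row∞-zeros-≡ []      = refl
  row∞-zeros-≡ (i ∷ s) = begin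
    W∞ i 0F i 0F * row∞ s (zeros _) s                  ≈⟨ *-cong (W∞-zero-≡ i) (row∞-zeros-≡ s) ⟩
    q ^ (2 ℕ.* toℕ i) * q ^ (2 ℕ.* weight s)           ≈⟨ ^-homo-* q (2 ℕ.* toℕ i) _ ⟨
    q ^ (2 ℕ.* toℕ i ℕ.+ 2 ℕ.* weight s)               ≈⟨ ^-congʳ q (ℕ.*-distribˡ-+ 2 (toℕ i) _) ⟨
    q ^ (2 ℕ.* weight (i ∷ s))                         ∎

-- The partition function and its limit

module Partition {ℓ₀ ℓ₁ ℓ₂ r ρ₁ ρ₂ ρ₃} (𝔽 : HeytingField ℓ₀ ℓ₁ ℓ₂) (𝕍 : OrderedField r ρ₁ ρ₂ ρ₃)
  (abs : AbsoluteValue 𝔽 𝕍) (q : HeytingField.Carrier 𝔽) (q#0 : HeytingField._#_ 𝔽 q (HeytingField.0# 𝔽))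
  (z : ℕ → HeytingField.Carrier 𝔽) where
  open HeytingField 𝔽 hiding (zero)
  open FieldProperties 𝔽
  open IzerginKorepin 𝔽 q q#0 z
  open Sums 𝔽 q q#0 z
  open Weights 𝔽 𝕍 abs q q#0 z
  open SetoidReasoning setoid

  -- The Boltzmann weight of a configuration: h lists the horizontal states row
  -- by row, v the vertical ones level by level.
  rows : ∀ {L N} → Vec (∃ (Regular L)) N → Vec (Vec State (suc L)) N → Vec (Vec State L) (suc N) → Carrier
  rows xs h v = ∏ λ r → row (lookup xs r) (lookup v (inject₁ r)) (lookup h r) (lookup v (suc r))

  rows-∷ʳ : ∀ {L N} (xs : Vec (∃ (Regular L)) N) t h ρ v s →
            rows (xs ∷ʳ t) (h ∷ʳ ρ) (v ∷ʳ s) ≈ rows xs h v * row t (last v) ρ s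
  rows-∷ʳ []       t []       ρ (u ∷ [])     s = trans (*-identityʳ _) (sym (*-identityˡ _))
  rows-∷ʳ (x ∷ xs) t (ρ′ ∷ h) ρ (u ∷ u′ ∷ v) s =
    trans (*-congˡ (rows-∷ʳ xs t h ρ (u′ ∷ v) s)) (sym (*-assoc _ _ _))

  module _ {a} {A : Set a} (x : A → Carrier) where
    open Limits abs x

    tends-∑ : ∀ {b} {B : Set b} (bs : List B) {f : B → A → Carrier} {g} →
              (∀ y → Tends (f y) (g y)) → Tends (λ t → ∑ bs (λ y → f y t)) (∑ bs g)
    tends-∑ List.[]       h = tends-const 0#
    tends-∑ (y List.∷ bs) h = tends-+ (h y) (tends-∑ bs h)

    tends-when : ∀ {p} {P : Set p} (P? : Dec P) {f b} → Tends f b → Tends (λ t → when P? (f t)) (when P? b)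
    tends-when (yes _) h = h
    tends-when (no _)  h = tends-const 0#

  replicate-∷ʳ : ∀ {a} {A : Set a} n (x : A) → replicate (suc n) x ≡ replicate n x ∷ʳ x
  replicate-∷ʳ zero    x = ≡.refl
  replicate-∷ʳ (suc n) x = ≡.cong (x ∷_) (replicate-∷ʳ n x)

  head-∷ʳ : ∀ {a} {A : Set a} {n} (v : Vec A (suc n)) x → head (v ∷ʳ x) ≡ head v
  head-∷ʳ (_ ∷ _) x = ≡.refl

  last-zeros : ∀ n → last (zeros (suc n)) ≡ 0F
  last-zeros zero    = ≡.refl
  last-zeros (suc n) = last-zeros n

  module _ {L N : ℕ} {I : Vec State N} {i : State} {S : Vec State L}
           {h : Vec (Vec State (suc L)) N} {ρ : Vec State (suc L)}
           {v : Vec (Vec State L) (suc N)} {s : Vec State L} where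

    -- The boundary conditions with a last row ρ are those of the other rows, with
    -- the vertical states below ρ as top boundary, and those of ρ itself.
    boundary-∷ʳ⁻ : Boundary (I ∷ʳ i) S (h ∷ʳ ρ) (v ∷ʳ s) →
      Boundary I (last v) h v × head ρ ≡ i × last ρ ≡ 0F × s ≡ S
    boundary-∷ʳ⁻ (left , right , bottom , top)
      with ∷ʳ-injective (Vec.map head h) I (≡.trans (≡.sym (map-∷ʳ head ρ h)) left)
         | ∷ʳ-injective (Vec.map last h) (replicate _ 0F)
             (≡.trans (≡.sym (map-∷ʳ last ρ h)) (≡.trans right (replicate-∷ʳ N 0F)))
    ... | left′ , head-ρ | right′ , last-ρ =
      (left′ , right′ , ≡.trans (≡.sym (head-∷ʳ v s)) bottom , ≡.refl) ,
      head-ρ , last-ρ , ≡.trans (≡.sym (last-∷ʳ s v)) top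

    boundary-∷ʳ⁺ : Boundary I (last v) h v → head ρ ≡ i → last ρ ≡ 0F → s ≡ S →
      Boundary (I ∷ʳ i) S (h ∷ʳ ρ) (v ∷ʳ s)
    boundary-∷ʳ⁺ (left , right , bottom , _) head-ρ last-ρ s≡S =
      ≡.trans (map-∷ʳ head ρ h) (≡.cong₂ _∷ʳ_ left head-ρ) ,
      ≡.trans (map-∷ʳ last ρ h) (≡.trans (≡.cong₂ _∷ʳ_ right last-ρ) (≡.sym (replicate-∷ʳ N 0F))) ,
      ≡.trans (head-∷ʳ v s) bottom ,
      ≡.trans (last-∷ʳ s v) s≡S

  module _ {N : ℕ} (S : TwoString) (I : Vec State N) (xs : Vec (Param S) N) where
    open TwoString S renaming (bound to L)

    ∑-configurations : ∀ {M} (J : Vec State M) f → ∑ (configurations J entries) f ≈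
      ∑ (words (states (suc L)) M) λ h → ∑ (words (states L) (suc M)) λ v →
        when (boundary? J entries h v) (f (h , v))
    ∑-configurations {M} J f = trans
      (∑-filter (λ (h , v) → boundary? J entries h v) (cartesianProduct hs vs) f)
      (∑-cartesianProductWith _,_ hs vs _)
      where
      hs = words (states (suc L)) M
      vs = words (states L) (suc M)

    -- The partition function with one more row, of weight ω ρ u s, on top.
    extended : State → (Vec State (suc L) → Vec State L → Vec State L → Carrier) → Carrier
    extended i ω =
      ∑ (words (states (suc L)) N) λ h → ∑ (states (suc L)) λ ρ →
      ∑ (words (states L) (suc N)) λ v → ∑ (states L) λ s →
        when (boundary? (I ∷ʳ i) entries (h ∷ʳ ρ) (v ∷ʳ s)) (rows xs h v * ω ρ (last v) s)

    when-congʳ : ∀ {p} {P : Set p} (P? : Dec P) {x y} → x ≈ y → when P? x ≈ when P? y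
    when-congʳ P? x≈y = when-cong P? P? (λ p → p) (λ p → p) (λ _ → x≈y)

    F-∷ʳ : ∀ i t → F S (I ∷ʳ i) (xs ∷ʳ t) ≈ extended i (λ ρ u s → row t u ρ s)
    F-∷ʳ i t = begin
      F S (I ∷ʳ i) (xs ∷ʳ t)
        ≈⟨ ∑-configurations (I ∷ʳ i) (λ (h , v) → rows (xs ∷ʳ t) h v) ⟩
      (∑ (words (states (suc L)) (suc N)) λ h → ∑ (words (states L) (suc (suc N))) λ v →
        when (boundary? (I ∷ʳ i) entries h v) (rows (xs ∷ʳ t) h v))
        ≈⟨ ∑-words-∷ʳ (states (suc L)) N _ ⟩
      (∑ (words (states (suc L)) N) λ h → ∑ (states (suc L)) λ ρ → ∑ (words (states L) (suc (suc N))) λ v →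
        when (boundary? (I ∷ʳ i) entries (h ∷ʳ ρ) v) (rows (xs ∷ʳ t) (h ∷ʳ ρ) v))
        ≈⟨ (∑-cong (words (states (suc L)) N) λ h → ∑-cong (states (suc L)) λ ρ → trans
             (∑-words-∷ʳ (states L) (suc N) _)
             (∑-cong (words (states L) (suc N)) λ v → ∑-cong (states L) λ s →
               when-congʳ (boundary? (I ∷ʳ i) entries (h ∷ʳ ρ) (v ∷ʳ s)) (rows-∷ʳ xs t h ρ v s))) ⟩
      extended i (λ ρ u s → row t u ρ s) ∎

    -- In the limit the last row is forced to be horizontally empty, and the
    -- vertical states pass through it unchanged.
    extended-row∞ : ∀ i → extended i (λ ρ u s → row∞ u ρ s) ≈
                    when (i Fin.≟ 0F) (q ^ (2 ℕ.* ∣ S ∣ₛ) * F S I xs)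
    extended-row∞ i = begin
      extended i (λ ρ u s → row∞ u ρ s)
        ≈⟨ (∑-cong hs λ h → ∑-states-single (suc L) _ (zeros (suc L)) λ ρ ρ≢0 →
             ∑-zero vs λ v → ∑-zero (states L) λ s → when-false (boundary? (I ∷ʳ i) entries (h ∷ʳ ρ) (v ∷ʳ s)) λ b →
               trans (*-congˡ (row∞-nonzero (last v) ρ s (proj₁ (proj₂ (proj₂ (boundary-∷ʳ⁻ {v = v} b)))) ρ≢0)) (zeroʳ _)) ⟩
      (∑ hs λ h → ∑ vs λ v → ∑ (states L) λ s →
        when (boundary? (I ∷ʳ i) entries (h ∷ʳ zeros (suc L)) (v ∷ʳ s)) (rows xs h v * row∞ (last v) (zeros (suc L)) s))
        ≈⟨ (∑-cong hs λ h → ∑-cong vs λ v → ∑-states-single L _ entries λ s s≢S →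
             when-false (boundary? (I ∷ʳ i) entries (h ∷ʳ zeros (suc L)) (v ∷ʳ s)) λ b →
               contradiction (proj₂ (proj₂ (proj₂ (boundary-∷ʳ⁻ {v = v} b)))) s≢S) ⟩
      (∑ hs λ h → ∑ vs λ v →
        when (boundary? (I ∷ʳ i) entries (h ∷ʳ zeros (suc L)) (v ∷ʳ entries)) (rows xs h v * row∞ (last v) (zeros (suc L)) entries))
        ≈⟨ last-letter (i Fin.≟ 0F) ⟩
      when (i Fin.≟ 0F) (q ^ (2 ℕ.* ∣ S ∣ₛ) * F S I xs) ∎
      where
      hs = words (states (suc L)) N
      vs = words (states L) (suc N)

      Q : Carrier
      Q = q ^ (2 ℕ.* ∣ S ∣ₛ)

      summand : State → Vec (Vec State (suc L)) N → Vec (Vec State L) (suc N) → Carrier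
      summand i h v = when (boundary? (I ∷ʳ i) entries (h ∷ʳ zeros (suc L)) (v ∷ʳ entries))
                       (rows xs h v * row∞ (last v) (zeros (suc L)) entries)

      summand-0 : ∀ h v → Dec (last v ≡ entries) →
                  summand 0F h v ≈ Q * when (boundary? I entries h v) (rows xs h v)
      summand-0 h v (yes v≡S) = trans
        (when-cong (boundary? (I ∷ʳ 0F) entries (h ∷ʳ zeros (suc L)) (v ∷ʳ entries)) (boundary? I entries h v)
          (λ b → ≡.subst (λ s → Boundary I s h v) v≡S (proj₁ (boundary-∷ʳ⁻ b)))
          (λ b → boundary-∷ʳ⁺ (≡.subst (λ s → Boundary I s h v) (≡.sym v≡S) b) ≡.refl (last-zeros L) ≡.refl)
          (λ _ → trans
            (*-congˡ (trans (reflexive (≡.cong (λ u → row∞ u (zeros (suc L)) entries) v≡S)) (row∞-zeros-≡ entries)))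
            (*-comm (rows xs h v) Q)))
        (when-* (boundary? I entries h v) Q (rows xs h v))
      summand-0 h v (no v≢S) = trans
        (when-false (boundary? (I ∷ʳ 0F) entries (h ∷ʳ zeros (suc L)) (v ∷ʳ entries)) λ _ →
          trans (*-congˡ (row∞-zeros-≢ (last v) entries v≢S)) (zeroʳ _))
        (sym (trans (*-congˡ (when-false (boundary? I entries h v)
          λ (_ , _ , _ , v≡S) → contradiction v≡S v≢S)) (zeroʳ Q)))

      last-letter : (i≟0 : Dec (i ≡ 0F)) → ∑ hs (λ h → ∑ vs λ v → summand i h v) ≈ when i≟0 (Q * F S I xs)
      last-letter (no i≢0) = ∑-zero hs λ h → ∑-zero vs λ v →
        when-false (boundary? (I ∷ʳ i) entries (h ∷ʳ zeros (suc L)) (v ∷ʳ entries)) λ b →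
          contradiction (≡.sym (proj₁ (proj₂ (boundary-∷ʳ⁻ {v = v} b)))) i≢0
      last-letter (yes ≡.refl) = begin
        ∑ hs (λ h → ∑ vs λ v → summand 0F h v)
          ≈⟨ (∑-cong hs λ h → trans (∑-cong vs λ v → summand-0 h v (≡-dec Fin._≟_ (last v) entries)) (∑-*ˡ vs Q)) ⟩
        ∑ hs (λ h → Q * ∑ vs λ v → when (boundary? I entries h v) (rows xs h v))
          ≈⟨ ∑-*ˡ hs Q ⟩
        Q * ∑ hs (λ h → ∑ vs λ v → when (boundary? I entries h v) (rows xs h v))
          ≈⟨ *-congˡ (∑-configurations I (λ (h , v) → rows xs h v)) ⟨
        Q * F S I xs ∎

    open Limits abs {A = Param S} proj₁

    row-tends : ∀ u ρ s → Tends (λ t → row t u ρ s) (row∞ u ρ s)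
    row-tends u ρ s = tends-∏ L λ c → W-tends L c (lookup u c) (lookup ρ (inject₁ c)) (lookup s c) (lookup ρ (suc c))

    F-tends : ∀ i → Tends (λ t → F S (I ∷ʳ i) (xs ∷ʳ t))
                          (when (i Fin.≟ 0F) (q ^ (2 ℕ.* ∣ S ∣ₛ) * F S I xs))
    F-tends i = tends-cong (λ t → sym (F-∷ʳ i t)) (extended-row∞ i)
      (tends-∑ proj₁ (words (states (suc L)) N) λ h → tends-∑ proj₁ (states (suc L)) λ ρ →
       tends-∑ proj₁ (words (states L) (suc N)) λ v → tends-∑ proj₁ (states L) λ s →
       tends-when proj₁ (boundary? (I ∷ʳ i) entries (h ∷ʳ ρ) (v ∷ʳ s))
         (tends-* (tends-const (rows xs h v)) (row-tends (last v) ρ s)))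

-- Statistics of words ending in 0

weight-∷ʳ-0 : ∀ {n} (I : Vec State n) → weight (I ∷ʳ 0F) ≡ weight I
weight-∷ʳ-0 []      = ≡.refl
weight-∷ʳ-0 (i ∷ I) = ≡.cong (toℕ i ℕ.+_) (weight-∷ʳ-0 I)

c₁-∷ʳ-0 : ∀ {n} (I : Vec State n) → c₁ (I ∷ʳ 0F) ≡ c₁ I
c₁-∷ʳ-0 []      = ≡.refl
c₁-∷ʳ-0 (i ∷ I) with does (i Fin.≟ 1F)
... | true  = ≡.cong suc (c₁-∷ʳ-0 I)
... | false = c₁-∷ʳ-0 I

sum-map-∷ʳ : ∀ {a} {A : Set a} {n} (f : A → ℕ) (xs : Vec A n) x →
             Vec.sum (Vec.map f (xs ∷ʳ x)) ≡ f x ℕ.+ Vec.sum (Vec.map f xs)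
sum-map-∷ʳ f []       x = ≡.refl
sum-map-∷ʳ f (y ∷ xs) x = begin
  f y ℕ.+ Vec.sum (Vec.map f (xs ∷ʳ x))           ≡⟨ ≡.cong (f y ℕ.+_) (sum-map-∷ʳ f xs x) ⟩
  f y ℕ.+ (f x ℕ.+ Vec.sum (Vec.map f xs))        ≡⟨ x∙yz≈y∙xz (f y) (f x) _ ⟩
  f x ℕ.+ (f y ℕ.+ Vec.sum (Vec.map f xs))        ∎
  where
  open ≡-Reasoning
  open CommutativeSemigroupProperties ℕ.+-commutativeSemigroup using (x∙yz≈y∙xz)

inv-∷ʳ-0 : ∀ {n} (I : Vec State n) → inv (I ∷ʳ 0F) ≡ 2 ℕ.* weight I ℕ.+ inv I
inv-∷ʳ-0 []      = ≡.refl
inv-∷ʳ-0 (i ∷ I) = begin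
  Vec.sum (Vec.map f (I ∷ʳ 0F)) ℕ.+ inv (I ∷ʳ 0F)
    ≡⟨ ≡.cong₂ ℕ._+_ (sum-map-∷ʳ f I 0F) (inv-∷ʳ-0 I) ⟩
  (toℕ i ℕ.* 2 ℕ.+ Vec.sum (Vec.map f I)) ℕ.+ (2 ℕ.* weight I ℕ.+ inv I)
    ≡⟨ interchange (toℕ i ℕ.* 2) _ (2 ℕ.* weight I) _ ⟩
  (toℕ i ℕ.* 2 ℕ.+ 2 ℕ.* weight I) ℕ.+ inv (i ∷ I)
    ≡⟨ ≡.cong (λ m → (m ℕ.+ 2 ℕ.* weight I) ℕ.+ inv (i ∷ I)) (ℕ.*-comm (toℕ i) 2) ⟩
  (2 ℕ.* toℕ i ℕ.+ 2 ℕ.* weight I) ℕ.+ inv (i ∷ I)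
    ≡⟨ ≡.cong (ℕ._+ inv (i ∷ I)) (ℕ.*-distribˡ-+ 2 (toℕ i) (weight I)) ⟨
  2 ℕ.* weight (i ∷ I) ℕ.+ inv (i ∷ I) ∎
  where
  open ≡-Reasoning
  open CommutativeSemigroupProperties ℕ.+-commutativeSemigroup using (interchange)
  f : State → ℕ
  f j = toℕ i ℕ.* (2 ℕ.∸ toℕ j)

weight≤2n : ∀ {n} (I : Vec State n) → weight I ℕ.≤ 2 ℕ.* n
weight≤2n []      = ℕ.z≤n
weight≤2n {suc n} (i ∷ I) = ≡.subst (weight (i ∷ I) ℕ.≤_) (≡.sym (ℕ.*-suc 2 n))
  (ℕ.+-mono-≤ (Fin.toℕ≤pred[n] i) (weight≤2n I))

-- The limit of H

module _ {ℓ₀ ℓ₁ ℓ₂ r ρ₁ ρ₂ ρ₃} (𝔽 : HeytingField ℓ₀ ℓ₁ ℓ₂) (𝕍 : OrderedField r ρ₁ ρ₂ ρ₃)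
  (abs : AbsoluteValue 𝔽 𝕍) (q : HeytingField.Carrier 𝔽) (q#0 : HeytingField._#_ 𝔽 q (HeytingField.0# 𝔽))
  (z : ℕ → HeytingField.Carrier 𝔽) where
  open HeytingField 𝔽 hiding (zero)
  open FieldProperties 𝔽
  open IzerginKorepin 𝔽 q q#0 z
  open Sums 𝔽 q q#0 z
  open Weights 𝔽 𝕍 abs q q#0 z
  open Partition 𝔽 𝕍 abs q q#0 z
  open SetoidReasoning setoid

  -- The coefficient of F_S^I in H_S.
  coefficient : ∀ {n} → Vec State n → Carrier
  coefficient I = (- 1#) ^ (c₁ I ℕ./ 2) * (1# - q⁻¹) ^ c₁ I * q⁻¹ ^ inv I

  -- Appending 0 to I raises inv I by 2 ∣ I ∣ and preserves c₁ I.
  coefficient-∷ʳ-0 : ∀ {n} (I : Vec State n) → coefficient (I ∷ʳ 0F) * q ^ (2 ℕ.* weight I) ≈ coefficient I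
  coefficient-∷ʳ-0 I rewrite c₁-∷ʳ-0 I | inv-∷ʳ-0 I = begin
    b * q⁻¹ ^ (m ℕ.+ inv I) * q ^ m            ≈⟨ *-congʳ (*-congˡ (^-homo-* q⁻¹ m (inv I))) ⟩
    b * (q⁻¹ ^ m * q⁻¹ ^ inv I) * q ^ m        ≈⟨ *-assoc b _ _ ⟩
    b * ((q⁻¹ ^ m * q⁻¹ ^ inv I) * q ^ m)      ≈⟨ *-congˡ (*-congʳ (*-comm _ _)) ⟩
    b * ((q⁻¹ ^ inv I * q⁻¹ ^ m) * q ^ m)      ≈⟨ *-congˡ (*-assoc _ _ _) ⟩
    b * (q⁻¹ ^ inv I * (q⁻¹ ^ m * q ^ m))      ≈⟨ *-congˡ (*-congˡ (^-inverse q⁻¹*q≈1 m)) ⟩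
    b * (q⁻¹ ^ inv I * 1#)                     ≈⟨ *-congˡ (*-identityʳ _) ⟩
    b * q⁻¹ ^ inv I                            ∎
    where
    b : Carrier
    b = (- 1#) ^ (c₁ I ℕ./ 2) * (1# - q⁻¹) ^ c₁ I
    m : ℕ
    m = 2 ℕ.* weight I
    q⁻¹*q≈1 : q⁻¹ * q ≈ 1#
    q⁻¹*q≈1 = trans (*-congˡ (sym (x-0≈x q))) (recip-inverse q#0)

  module _ (n K : ℕ) (S : TwoString) (∣S∣≡2K : ∣ S ∣ₛ ≡ 2 ℕ.* K) (xs : Vec (Param S) n) where
    open TwoString S using (bound)

    private
      weight? : ∀ {m} (I : Vec State m) → Dec (weight I ≡ 2 ℕ.* K)
      weight? I = weight I ℕ.≟ 2 ℕ.* K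

      Q : Carrier
      Q = q ^ (2 ℕ.* ∣ S ∣ₛ)

    H-∷ʳ : ∀ t → H K S (xs ∷ʳ t) ≈ ∑ (states n) λ I → ∑ (allFin 3) λ i →
           when (weight? (I ∷ʳ i)) (coefficient (I ∷ʳ i) * F S (I ∷ʳ i) (xs ∷ʳ t))
    H-∷ʳ t = trans (∑-filter weight? (states (suc n)) λ I → coefficient I * F S I (xs ∷ʳ t))
                   (∑-words-∷ʳ (allFin 3) n λ I → when (weight? I) (coefficient I * F S I (xs ∷ʳ t)))

    private
      -- The limit of the term of H indexed by the word I ∷ʳ i.
      summand∞ : Vec State n → State → Carrier
      summand∞ I i = when (weight? (I ∷ʳ i)) (coefficient (I ∷ʳ i) * when (i Fin.≟ 0F) (Q * F S I xs))

    summand∞-0 : ∀ I → summand∞ I 0F ≈ when (weight? I) (coefficient I * F S I xs)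
    summand∞-0 I = when-cong (weight? (I ∷ʳ 0F)) (weight? I)
      (≡.trans (≡.sym (weight-∷ʳ-0 I))) (≡.trans (weight-∷ʳ-0 I)) λ weight≡2K → begin
        coefficient (I ∷ʳ 0F) * (Q * F S I xs)
          ≈⟨ *-assoc (coefficient (I ∷ʳ 0F)) Q (F S I xs) ⟨
        coefficient (I ∷ʳ 0F) * Q * F S I xs
          ≈⟨ *-congʳ (*-congˡ (^-congʳ q (≡.cong (2 ℕ.*_)
               (≡.trans ∣S∣≡2K (≡.trans (≡.sym weight≡2K) (weight-∷ʳ-0 I)))))) ⟩
        coefficient (I ∷ʳ 0F) * q ^ (2 ℕ.* weight I) * F S I xs
          ≈⟨ *-congʳ (coefficient-∷ʳ-0 I) ⟩
        coefficient I * F S I xs ∎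

    summand∞-≢0 : ∀ I i → i ≢ 0F → summand∞ I i ≈ 0#
    summand∞-≢0 I i i≢0 = when-false (weight? (I ∷ʳ i)) λ _ → trans
      (*-congˡ (when-false (i Fin.≟ 0F) λ i≡0 → contradiction i≡0 i≢0))
      (zeroʳ (coefficient (I ∷ʳ i)))

    H-limit : (∑ (states n) λ I → ∑ (allFin 3) (summand∞ I)) ≈ H K S xs
    H-limit = begin
      (∑ (states n) λ I → ∑ (allFin 3) (summand∞ I))
        ≈⟨ (∑-cong (states n) λ I → trans (∑-allFin-single (summand∞ I) 0F (summand∞-≢0 I)) (summand∞-0 I)) ⟩
      (∑ (states n) λ I → when (weight? I) (coefficient I * F S I xs))
        ≈⟨ ∑-filter weight? (states n) (λ I → coefficient I * F S I xs) ⟨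
      H K S xs ∎

    -- Words of length n have weight at most 2n, so the sum H has no terms.
    H-vanishes : ¬ ∣ S ∣ₛ ℕ.≤ 2 ℕ.* n → H K S xs ≈ 0#
    H-vanishes ∣S∣≰2n = trans (∑-filter weight? (states n) λ I → coefficient I * F S I xs)
      (∑-zero (states n) λ I → when-false (weight? I) λ weight≡2K →
        contradiction (≡.subst (ℕ._≤ 2 ℕ.* n) (≡.trans weight≡2K (≡.sym ∣S∣≡2K)) (weight≤2n I)) ∣S∣≰2n)

    private module Last = Limits abs {A = Param S} proj₁

    H-by-cases : (∣S∣≤2n? : Dec (∣ S ∣ₛ ℕ.≤ 2 ℕ.* n)) → H K S xs ≈ (if does ∣S∣≤2n? then H K S xs else 0#)
    H-by-cases (yes _)     = refl
    H-by-cases (no ∣S∣≰2n) = H-vanishes ∣S∣≰2n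

    H-tends : Last.Tends (λ t → H K S (xs ∷ʳ t)) (if does (∣ S ∣ₛ ≤? 2 ℕ.* n) then H K S xs else 0#)
    H-tends = Last.tends-cong (λ t → sym (H-∷ʳ t)) (trans H-limit (H-by-cases (∣ S ∣ₛ ≤? 2 ℕ.* n)))
      (tends-∑ proj₁ (states n) λ I → tends-∑ proj₁ (allFin 3) λ i →
        tends-when proj₁ (weight? (I ∷ʳ i))
          (Last.tends-* (Last.tends-const (coefficient (I ∷ʳ i))) (F-tends S I xs i)))

    open Limits abs {A = Carrier} (λ x → x)

    eventually-regular : ∀ L → Eventually (Regular L)
    eventually-regular L = eventually-∀ λ c →
      eventually-× (eventually-# (q ^ 2 * z (toℕ c))) (eventually-# (q ^ 3 * z (toℕ c)))

    limit : LimitAtInfinity abs (Regular bound) (λ x reg → H K S (xs ∷ʳ (x , reg)))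
              (if does (∣ S ∣ₛ ≤? 2 ℕ.* n) then H K S xs else 0#)
    limit ε 0<ε = eventually-× (eventually-regular bound) (curry (Last.difference-null H-tends ε 0<ε))
      where
      curry : ∀ {p} {P : Param S → Set p} →
              Last.Eventually P → Eventually (λ x → ∀ (reg : Regular bound x) → P (x , reg))
      curry (M , near) = M , λ x M<∣x∣ reg → near (x , reg) M<∣x∣

proposition1p7p3 : ∀ {c ℓ₁ ℓ₂ r ρ₁ ρ₂ ρ₃} (𝔽 : HeytingField c ℓ₁ ℓ₂) (𝕍 : OrderedField r ρ₁ ρ₂ ρ₃)
    (abs : AbsoluteValue 𝔽 𝕍) →
    let open HeytingField 𝔽 in
    (q : Carrier) (q#0 : q # 0#) (z : ℕ → Carrier) →
    let open IzerginKorepin 𝔽 q q#0 z in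
    (n K : ℕ) → let N = suc n in K ℕ.≤ N →
    (S : TwoString) → ∣ S ∣ₛ ≡ 2 ℕ.* K →
    (xs : Vec (Param S) n) →
    LimitAtInfinity abs (Regular (TwoString.bound S))
    (λ x reg → H K S (xs ∷ʳ (x , reg)))
    (if does (∣ S ∣ₛ ≤? 2 ℕ.* n) then H K S xs else 0#)
proposition1p7p3 𝔽 𝕍 abs q q#0 z n K _ S ∣S∣≡2K xs = limit 𝔽 𝕍 abs q q#0 z n K S ∣S∣≡2K xs
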